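{- For all integers $n,m\ge 1$, the comb graph $C_{n,m}$ satisfies $b(C_{n,m}) \le \lceil \sqrt{nm}\,\rceil$.
   Context: The burning number of a graph $G$ is $b(G)=\min\{k : \exists v_1,\dots,v_k\in V(G) \text{ with } V(G)=\bigcup_{i=1}^k B(v_i,k-i)\}$, where $B(v,r)$ is the set of vertices at graph distance at most $r$ from $v$. The comb graph $C_{n,m}$ is the rooted product $P_n\circ P_m$ with root an end-vertex of $P_m$: it has vertex set $\{(i,j): 1\le i\le m,\ 1\le j\le n\}$, with edges $(1,j)\sim(1,j+1)$ for $1\le j<n$ (the spine) and $(i,j)\sim(i+1,j)$ for $1\le i<m$ (tooth $j$). It has $nm$ vertices. -}

module Defs where

open import Data.Nat using (ℕ; zero; suc; _+_; _*_; _∸_; _≤_; _<_)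
open import Data.Fin using (Fin; toℕ)
open import Data.Product using (Σ; _×_; _,_; ∃)
open import Relation.Binary.PropositionalEquality using (_≡_)

record Graph : Set₁ where
  field
    V   : Set
    _~_ : V → V → Set
open Graph public

data Reach (G : Graph) : ℕ → V G → V G → Set where
  here : ∀ {r u} → Reach G r u u
  step : ∀ {r u w v} → _~_ G u w → Reach G r w v → Reach G (ℕ.suc r) u v

InBall : (G : Graph) → V G → ℕ → V G → Set
InBall G u r v = Reach G r u v

-- A burning sequence of length k: sources v_1..v_k (0-indexed here as
-- v_0..v_{k-1}) with V(G) = ⋃_i B(v_i, k - i)  (1-indexed), i.e.
-- radius k - 1 - i for 0-indexed i.
BurningSeq : (G : Graph) → ℕ → Set
BurningSeq G k =
  Σ (Fin k → V G) λ vs →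
    (u : V G) → Σ (Fin k) λ i → InBall G (vs i) (k ∸ ℕ.suc (toℕ i)) u

-- b(G) ≤ c  (b(G) is the least k admitting a burning sequence)
BurningNumber≤ : Graph → ℕ → Set
BurningNumber≤ G c = Σ ℕ λ k → k ≤ c × BurningSeq G k

IsCeilSqrt : ℕ → ℕ → Set
IsCeilSqrt N c = (N ≤ c * c) × (∀ d → N ≤ d * d → c ≤ d)

-- Comb graph C_{n,m}: vertex (i, j) with i ∈ Fin m (position on tooth,
-- 0 = on the spine) and j ∈ Fin n (which tooth), 0-indexed.
data CombAdj (n m : ℕ) : (Fin m × Fin n) → (Fin m × Fin n) → Set where
  spineR : ∀ (i : Fin m) (j j' : Fin n) → toℕ i ≡ 0 → ℕ.suc (toℕ j) ≡ toℕ j' → CombAdj n m (i , j) (i , j')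
  spineL : ∀ (i : Fin m) (j j' : Fin n) → toℕ i ≡ 0 → ℕ.suc (toℕ j') ≡ toℕ j → CombAdj n m (i , j) (i , j')
  toothD : ∀ (i i' : Fin m) (j : Fin n) → ℕ.suc (toℕ i) ≡ toℕ i' → CombAdj n m (i , j) (i' , j)
  toothU : ∀ (i i' : Fin m) (j : Fin n) → ℕ.suc (toℕ i') ≡ toℕ i → CombAdj n m (i , j) (i' , j)

Comb : ℕ → ℕ → Graph
Comb n m = record { V = Fin m × Fin n ; _~_ = CombAdj n m }

{-# OPTIONS --safe #-}

-- Write N for the number of teeth still unburnt and k for the number of balls left (radii 0, …, k − 1),
-- so that N m ≤ k².
--
-- If m < k, a ball of radius k − 1 centred on the spine swallows 2(k − m) + 1 whole teeth, that is at
-- least 2k − 1 vertices, and (N, k) is replaced by a smaller pair with N m ≤ (k − 1)².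
--
-- If k ≤ m, then N ≤ k.  For N ≤ 2 the teeth lie on a path.  For N ≥ 3 put the ball of radius k − 1
-- at the end of the spine; on tooth j a path of length m − k + j survives.  When k < 2N these N paths
-- are short enough to be covered by one ball each.  When k ≥ 2N they are covered by the following fact:
-- n disjoint paths of total length at most k² − (n − 1)², with n ≤ k, are covered by k balls.
-- Indeed, if all of them have length at most 2(k − n) + 1, the n largest balls do; otherwise spend the
-- largest ball on a longer path, which either removes that path or covers exactly 2k − 1 vertices.
module Submission where

open import Defs hiding (here; step)
open import Data.Fin using (Fin; zero; suc; toℕ)
open import Data.Fin.Properties using (toℕ<n; toℕ-fromℕ<; toℕ-injective)
open import Data.Empty using (⊥; ⊥-elim)
open import Data.List using (List; []; _∷_; length; map; downFrom)
open import Data.List.Membership.Propositional using (lose)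
open import Data.List.Membership.Propositional.Properties using (∈-downFrom⁺)
open import Data.List.Properties using (length-map; length-downFrom)
open import Data.List.Relation.Binary.Permutation.Propositional using (_↭_; ↭-refl; ↭-trans; prep; swap)
open import Data.List.Relation.Binary.Permutation.Propositional.Properties using (↭-length; Any-resp-↭; map⁺)
open import Data.List.Relation.Unary.All using (All; []; _∷_)
open import Data.List.Relation.Unary.Any using (Any; here; there)
import Data.List.Relation.Unary.Any.Properties as Any
open import Data.Nat using (ℕ; zero; suc; pred; _+_; _*_; _∸_; _≤_; _<_; ∣_-_∣; z≤n; s≤s; s≤s⁻¹; NonZero; >-nonZero; >-nonZero⁻¹)
open import Data.Nat.DivMod using (_mod_; m<n⇒m%n≡m)
open import Data.Nat.ListAction using (sum)
open import Data.Nat.ListAction.Properties using (sum-↭)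
open import Data.Nat.Properties
open import Data.Nat.Tactic.RingSolver using (solve-∀)
open import Data.Product using (Σ; ∃; _×_; _,_; proj₁; proj₂)
open import Data.Sum using (_⊎_; inj₁; inj₂)
open import Relation.Binary.PropositionalEquality using (_≡_; refl; sym; trans; cong; cong₂; subst; subst₂)
open import Relation.Nullary using (yes; no; contradiction)

-- Differences and squares of natural numbers.

∣m-n∣≤ : ∀ {m n r} → m ≤ n + r → n ≤ m + r → ∣ m - n ∣ ≤ r
∣m-n∣≤ {m} {n} {r} m≤n+r n≤m+r with ≤-total m n
... | inj₁ m≤n = subst (_≤ r) (sym (m≤n⇒∣m-n∣≡n∸m m≤n)) (m≤n+o⇒m∸n≤o n m n≤m+r)
... | inj₂ n≤m = subst (_≤ r) (sym (m≤n⇒∣n-m∣≡n∸m n≤m)) (m≤n+o⇒m∸n≤o m n m≤n+r)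

m∸1+n<m : ∀ {m} n → 0 < m → m ∸ suc n < m
m∸1+n<m {suc m} n _ = s≤s (m∸n≤m m n)

-- With `k = suc n + e`, passing from `suc k` to `k` costs `2k + 1 = (2e + 2) + (2n + 1)`. The
-- dropped length `l` pays the first summand, the fall from `suc n * suc n` to `n * n` the second.
drop-one : ∀ n e l T → suc (e + e) < l → (l + T) + suc n * suc n ≤ suc (suc n + e) * suc (suc n + e) →
  T + n * n ≤ (suc n + e) * (suc n + e)
drop-one n e l T long bound = +-cancelʳ-≤ (suc (suc (e + e)) + suc (n + n)) _ _ (begin
  T + n * n + (suc (suc (e + e)) + suc (n + n))   ≡⟨ regroup n e T ⟩
  (suc (suc (e + e)) + T) + suc n * suc n         ≤⟨ +-monoˡ-≤ _ (+-monoˡ-≤ T long) ⟩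
  (l + T) + suc n * suc n                         ≤⟨ bound ⟩
  suc (suc n + e) * suc (suc n + e)               ≡⟨ expand n e ⟩
  (suc n + e) * (suc n + e) + (suc (suc (e + e)) + suc (n + n)) ∎)
  where
  open ≤-Reasoning
  regroup : ∀ n e T → T + n * n + (suc (suc (e + e)) + suc (n + n)) ≡ (suc (suc (e + e)) + T) + suc n * suc n
  regroup = solve-∀
  expand : ∀ n e → suc (suc n + e) * suc (suc n + e) ≡ (suc n + e) * (suc n + e) + (suc (suc (e + e)) + suc (n + n))
  expand = solve-∀

shrink-one : ∀ k l X → suc (k + k) + l + X ≤ suc k * suc k → l + X ≤ k * k
shrink-one k l X bound = +-cancelˡ-≤ (suc (k + k)) _ _ (begin
  suc (k + k) + (l + X) ≡⟨ +-assoc (suc (k + k)) l X ⟨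
  suc (k + k) + l + X   ≤⟨ bound ⟩
  suc k * suc k         ≡⟨ expand k ⟩
  suc (k + k) + k * k   ∎)
  where
  open ≤-Reasoning
  expand : ∀ k → suc k * suc k ≡ suc (k + k) + k * k
  expand = solve-∀

square-cancel-< : ∀ {a b} → a * a < b * b → a < b
square-cancel-< a²<b² = ≰⇒> λ b≤a → <⇒≱ a²<b² (*-mono-≤ b≤a b≤a)

-- Burning sets of vertices, largest ball first.

module _ (G : Graph) where

  -- Relative to a set, so that an induction can discard what is already burnt; distances are still
  -- measured in all of `G`.
  Burns : ℕ → (V G → Set) → Set
  Burns k P = Σ (Fin k → V G) λ vs →
    (u : V G) → P u → Σ (Fin k) λ i → InBall G (vs i) (k ∸ suc (toℕ i)) u

module _ {G : Graph} where

  reach-mono : ∀ {r s u v} → r ≤ s → Reach G r u v → Reach G s u v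
  reach-mono r≤s       Reach.here       = Reach.here
  reach-mono (s≤s r≤s) (Reach.step e p) = Reach.step e (reach-mono r≤s p)

  reach-trans : ∀ {r s u v w} → Reach G r u v → Reach G s v w → Reach G (r + s) u w
  reach-trans {r} {s} Reach.here q = reach-mono (m≤n+m s r) q
  reach-trans (Reach.step e p)   q = Reach.step e (reach-trans p q)

  burns-cong : ∀ {k P Q} → (∀ u → Q u → P u) → Burns G k P → Burns G k Q
  burns-cong Q⊆P (vs , covers) = vs , λ u u∈Q → covers u (Q⊆P u u∈Q)

  burns-empty : ∀ {k P} → V G → (∀ u → P u → ⊥) → Burns G k P
  burns-empty v empty = (λ _ → v) , λ u u∈P → ⊥-elim (empty u u∈P)

  -- The new source takes the largest radius `k`. The old ones move up one index while the number of
  -- balls grows by one, so their radii do not change.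
  ignite : ∀ {k P Q} v → (∀ u → Q u → Reach G k v u ⊎ P u) → Burns G k P → Burns G (suc k) Q
  ignite {k} {P} {Q} v split (vs , covers) = vs′ , covers′
    where
    vs′ : Fin (suc k) → V G
    vs′ zero    = v
    vs′ (suc i) = vs i

    covers′ : ∀ u → Q u → Σ (Fin (suc k)) λ i → InBall G (vs′ i) (suc k ∸ suc (toℕ i)) u
    covers′ u u∈Q with split u u∈Q
    ... | inj₁ reach = zero , reach
    ... | inj₂ u∈P with covers u u∈P
    ...   | i , reach = suc i , reach

  -- Paths in a graph and balls centred on them.

  -- Both directions of an edge are recorded because a `Graph` need not be symmetric. `at` is total,
  -- so that cutting off an initial piece is a mere shift; its values from `len` on carry no
  -- meaning.
  record Segment : Set where
    field
      len  : ℕ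
      at   : ℕ → V G
      next : ∀ t → suc t < len → _~_ G (at t) (at (suc t))
      prev : ∀ t → suc t < len → _~_ G (at (suc t)) (at t)
  open Segment public

  _On_ : V G → Segment → Set
  u On s = ∃ λ t → t < len s × at s t ≡ u

  forward : ∀ s a d → a + d < len s → Reach G d (at s a) (at s (a + d))
  forward s a zero    _ rewrite +-identityʳ a = Reach.here
  forward s a (suc d) lt rewrite +-suc a d =
    Reach.step (next s a (≤-trans (s≤s (s≤s (m≤m+n a d))) lt)) (forward s (suc a) d lt)

  backward : ∀ s a d → a + d < len s → Reach G d (at s (a + d)) (at s a)
  backward s a zero    _ rewrite +-identityʳ a = Reach.here
  backward s a (suc d) lt rewrite +-suc a d =
    Reach.step (prev s (a + d) lt) (backward s a d (<-trans (n<1+n _) lt))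

  segment-reach : ∀ s {a b} → a < len s → b < len s → Reach G ∣ a - b ∣ (at s a) (at s b)
  segment-reach s {a} {b} a< b< with ≤-total a b
  ... | inj₁ a≤b = subst₂ (λ d c → Reach G d (at s a) (at s c)) (sym (m≤n⇒∣m-n∣≡n∸m a≤b)) (m+[n∸m]≡n a≤b)
        (forward s a (b ∸ a) (subst (_< len s) (sym (m+[n∸m]≡n a≤b)) b<))
  ... | inj₂ b≤a = subst₂ (λ d c → Reach G d (at s c) (at s b)) (sym (m≤n⇒∣n-m∣≡n∸m b≤a)) (m+[n∸m]≡n b≤a)
        (backward s b (a ∸ b) (subst (_< len s) (sym (m+[n∸m]≡n b≤a)) a<))

  -- Position `r` reaches `r` steps both ways. If the segment has no position `r`, it is so short
  -- that position `0` reaches all of it.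
  segment-ball : ∀ s r → ∃ λ v → ∀ t → t < len s → t ≤ r + r → Reach G r v (at s t)
  segment-ball s r with r <? len s
  ... | yes r< = at s r , λ t t< t≤2r →
        reach-mono (∣m-n∣≤ (m≤n+m r t) t≤2r) (segment-reach s r< t<)
  ... | no r≮  = at s 0 , λ t t< _ →
        reach-mono (≤-trans (<⇒≤ t<) (≮⇒≥ r≮)) (segment-reach s (≤-<-trans z≤n t<) t<)

  skip : ℕ → Segment → Segment
  skip c s = record
    { len  = len s ∸ c
    ; at   = λ t → at s (c + t)
    ; next = λ t lt → subst (λ x → _~_ G (at s (c + t)) (at s x)) (sym (+-suc c t)) (next s (c + t) (shift t lt))
    ; prev = λ t lt → subst (λ x → _~_ G (at s x) (at s (c + t))) (sym (+-suc c t)) (prev s (c + t) (shift t lt))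
    }
    where
    shift : ∀ t → suc t < len s ∸ c → suc (c + t) < len s
    shift t lt = ≰⇒> λ len≤ → <⇒≱ lt (m≤n+o⇒m∸n≤o (len s) c (subst (len s ≤_) (sym (+-suc c t)) len≤))

  on-skip : ∀ s {c t} → c ≤ t → t < len s → at s t On skip c s
  on-skip s {c} {t} c≤t t< = t ∸ c , ∸-monoˡ-< t< c≤t , cong (at s) (m+[n∸m]≡n c≤t)

  -- Covering a family of paths by balls.

  OnAny : List Segment → V G → Set
  OnAny ss u = Any (u On_) ss

  total : List Segment → ℕ
  total ss = sum (map len ss)

  -- The segments can be served in order by the balls of radii e + length ss − 1, …, e.
  data Fits (e : ℕ) : List Segment → Set where
    []  : Fits e []
    _∷_ : ∀ {s ss} → len s ≤ suc ((e + length ss) + (e + length ss)) → Fits e ss → Fits e (s ∷ ss)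

  short⇒fits : ∀ {e ss} → All (λ s → len s ≤ suc (e + e)) ss → Fits e ss
  short⇒fits []           = []
  short⇒fits {e} (s≤ ∷ ss≤) =
    ≤-trans s≤ (s≤s (+-mono-≤ (m≤m+n e _) (m≤m+n e _))) ∷ short⇒fits ss≤

  fits⇒burns : ∀ {e ss} → V G → Fits e ss → Burns G (e + length ss) (OnAny ss)
  fits⇒burns v [] = burns-empty v λ _ ()
  fits⇒burns {e} {s ∷ ss} v (s≤ ∷ fits) with segment-ball s (e + length ss)
  ... | centre , ball = subst (λ k → Burns G k (OnAny (s ∷ ss))) (sym (+-suc e (length ss)))
        (ignite centre split (fits⇒burns v fits))
    where
    split : ∀ u → OnAny (s ∷ ss) u → Reach G (e + length ss) centre u ⊎ OnAny ss u
    split u (here (t , t< , refl)) = inj₁ (ball t t< (s≤s⁻¹ (≤-trans t< s≤)))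
    split u (there on)             = inj₂ on

  pick-long : ∀ b ss → All (λ s → len s ≤ b) ss ⊎ ∃ λ s → ∃ λ rest → ss ↭ s ∷ rest × b < len s
  pick-long b [] = inj₁ []
  pick-long b (s ∷ ss) with b <? len s | pick-long b ss
  ... | yes long | _ = inj₂ (s , ss , ↭-refl , long)
  ... | no short | inj₁ shorts = inj₁ (≮⇒≥ short ∷ shorts)
  ... | no _     | inj₂ (s′ , rest , perm , long) =
        inj₂ (s′ , s ∷ rest , ↭-trans (prep s perm) (swap s s′ ↭-refl) , long)

  total-↭ : ∀ {ss ss′} → ss ↭ ss′ → total ss ≡ total ss′
  total-↭ perm = sum-↭ (map⁺ len perm)

  -- The square on the left is a reserve. With `k` balls and `n` paths, a removed path may have only
  -- `2(k − n) + 2` vertices, a waste of `2n − 3` against the `2k − 1` that the largest ball can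
  -- cover; this is exactly `(n − 1)² − (n − 2)²`. Cutting a longer path wastes nothing and leaves
  -- the reserve alone.
  burns-segments : ∀ k ss → V G → length ss ≤ k →
    total ss + pred (length ss) * pred (length ss) ≤ k * k → Burns G k (OnAny ss)
  burns-segments k [] v _ _ = burns-empty v λ _ ()
  burns-segments (suc k) ss@(_ ∷ ss₀) v len≤ bound
    -- The surplus of balls over paths, `k ∸ length ss₀`, is also the smallest radius in use when
    -- the largest balls serve one path each.
    with pick-long (suc ((k ∸ length ss₀) + (k ∸ length ss₀))) ss
  ... | inj₁ shorts = subst (λ j → Burns G j (OnAny ss)) eq (fits⇒burns v (short⇒fits shorts))
    where
    eq : (k ∸ length ss₀) + suc (length ss₀) ≡ suc k
    eq = trans (+-suc (k ∸ length ss₀) (length ss₀)) (cong suc (m∸n+n≡m (s≤s⁻¹ len≤)))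
  ... | inj₂ (s , rest , perm , long) with len s ≤? suc (k + k) | segment-ball s k
  ...   | yes s≤ | centre , ball = ignite centre split (remaining rest length≡ bound′)
    where
    length≡ : length ss₀ ≡ length rest
    length≡ = suc-injective (↭-length perm)

    bound′ : (len s + total rest) + length ss₀ * length ss₀ ≤ suc k * suc k
    bound′ = subst (λ x → x + length ss₀ * length ss₀ ≤ suc k * suc k) (total-↭ perm) bound

    remaining : ∀ rest → length ss₀ ≡ length rest →
      (len s + total rest) + length ss₀ * length ss₀ ≤ suc k * suc k → Burns G k (OnAny rest)
    -- After the last path nothing is left to cover. Otherwise `length ss₀` is a successor, as
    -- `drop-one` requires.
    remaining []           _  _ = burns-empty v λ _ ()
    remaining rest@(_ ∷ rest₀) eq b = burns-segments k rest v n<k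
      (subst (λ x → total rest + n * n ≤ x * x) k≡
        (drop-one n e (len s) (total rest) long′
          (subst₂ (λ x y → (len s + total rest) + x * x ≤ suc y * suc y) eq (sym k≡) b)))
      where
      n = length rest₀
      e = k ∸ suc n
      n<k : suc n ≤ k
      n<k = subst (_≤ k) eq (s≤s⁻¹ len≤)
      k≡ : suc n + e ≡ k
      k≡ = m+[n∸m]≡n n<k
      long′ : suc (e + e) < len s
      long′ = subst (λ x → suc ((k ∸ x) + (k ∸ x)) < len s) eq long

    split : ∀ u → OnAny ss u → Reach G k centre u ⊎ OnAny rest u
    split u on with Any-resp-↭ perm on
    ... | here (t , t< , refl) = inj₁ (ball t t< (s≤s⁻¹ (≤-trans t< s≤)))
    ... | there on′            = inj₂ on′
  ...   | no s≰ | centre , ball = ignite centre split (burns-segments k (s′ ∷ rest) v fewer bound‴)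
    where
    s′ = skip (suc (k + k)) s

    bound′ : suc (k + k) + len s′ + (total rest + length ss₀ * length ss₀) ≤ suc k * suc k
    bound′ = subst (_≤ suc k * suc k)
      (trans (cong (_+ length ss₀ * length ss₀) (total-↭ perm))
        (trans (+-assoc (len s) (total rest) _)
          (cong (_+ (total rest + length ss₀ * length ss₀)) (sym (m+[n∸m]≡n (<⇒≤ (≰⇒> s≰)))))))
      bound

    bound″ : len s′ + (total rest + length ss₀ * length ss₀) ≤ k * k
    bound″ = shrink-one k (len s′) _ bound′

    length≡ : length ss₀ ≡ length rest
    length≡ = suc-injective (↭-length perm)

    -- A ball is gone but no path is. The cut path keeps at least one vertex, which makes the
    -- inequality between the two squares strict.
    fewer : suc (length rest) ≤ k
    fewer = subst (_< k) length≡ (square-cancel-<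
      (≤-trans (+-mono-≤ (m<n⇒0<n∸m (≰⇒> s≰)) (m≤n+m _ (total rest))) bound″))

    bound‴ : (len s′ + total rest) + length rest * length rest ≤ k * k
    bound‴ = subst (λ x → (len s′ + total rest) + x * x ≤ k * k) length≡
      (subst (_≤ k * k) (sym (+-assoc (len s′) (total rest) _)) bound″)

    split : ∀ u → OnAny ss u → Reach G k centre u ⊎ OnAny (s′ ∷ rest) u
    split u on with Any-resp-↭ perm on
    ... | there on′ = inj₂ (there on′)
    ... | here (t , t< , refl) with t ≤? k + k
    ...   | yes t≤ = inj₁ (ball t t< t≤)
    ...   | no t≰  = inj₂ (here (on-skip s (≰⇒> t≰) t<))

  -- A lone path has reserve `0`: this is the classical bound for the burning number of a path.
  -- Nonemptiness forces `k ≥ 1`, hence a ball for it.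
  burns-segment : ∀ {k} s → V G → 0 < len s → len s ≤ k * k → Burns G k (_On s)
  burns-segment {k} s v 0<len bound = burns-cong (λ _ → here) (burns-segments k (s ∷ []) v
    (square-cancel-< (≤-trans 0<len bound))
    (subst (_≤ k * k) (sym (trans (+-identityʳ _) (+-identityʳ (len s)))) bound))

  -- The descending order matters: `f j` is followed by `j` segments, so `Fits e` allots it the ball
  -- of radius `e + j`.
  indexed : (ℕ → Segment) → ℕ → List Segment
  indexed f n = map f (downFrom n)

  length-indexed : ∀ f n → length (indexed f n) ≡ n
  length-indexed f n = trans (length-map f (downFrom n)) (length-downFrom n)

  on-indexed : ∀ {f n j u} → j < n → u On f j → OnAny (indexed f n) u
  on-indexed j<n on = Any.map⁺ (lose (∈-downFrom⁺ j<n) on)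

  indexed-fits : ∀ {e f} n → (∀ j → len (f j) ≤ suc ((e + j) + (e + j))) → Fits e (indexed f n)
  indexed-fits zero    _ = []
  indexed-fits {e} {f} (suc n) h =
    subst (λ x → len (f n) ≤ suc ((e + x) + (e + x))) (sym (length-indexed f n)) (h n) ∷ indexed-fits n h

  -- An arithmetic series, doubled to avoid the division in `n (n − 1) / 2`.
  total-indexed : ∀ {a f} n → (∀ j → len (f j) ≤ a + j) →
    let T = total (indexed f n) in (T + T) + n ≤ (n * a + n * a) + n * n
  total-indexed zero    _ = z≤n
  total-indexed {a} {f} (suc n) h = begin
    (l + T + (l + T)) + suc n                     ≡⟨ regroup l T n ⟩
    suc (l + l) + ((T + T) + n)                   ≤⟨ +-mono-≤ (s≤s (+-mono-≤ (h n) (h n))) (total-indexed n h) ⟩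
    suc ((a + n) + (a + n)) + ((n * a + n * a) + n * n) ≡⟨ collect a n ⟩
    (suc n * a + suc n * a) + suc n * suc n       ∎
    where
    open ≤-Reasoning
    l = len (f n)
    T = total (indexed f n)
    regroup : ∀ l T n → (l + T + (l + T)) + suc n ≡ suc (l + l) + ((T + T) + n)
    regroup = solve-∀
    collect : ∀ a n → suc ((a + n) + (a + n)) + ((n * a + n * a) + n * n) ≡ (suc n * a + suc n * a) + suc n * suc n
    collect = solve-∀

-- Counting inequalities for the comb.

-- Here `n` is the number of teeth, `k = suc q = 2n + y` and `m = k + a`. The corner ball burns
-- `n k − n (n − 1) / 2` vertices, enough to pay both the `2k − 1` lost on the right and the reserve
-- `(n − 1)²`.
tails-bound : ∀ x y a T → let n = 3 + x ; q = 5 + (x + x) + y in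
  (T + T) + n ≤ (n * a + n * a) + n * n → n * (suc q + a) ≤ suc q * suc q →
  T + (2 + x) * (2 + x) ≤ q * q
tails-bound x y a T h₁ h₂ = *-cancelˡ-≤ 2 (+-cancelʳ-≤ (n + 2 * (n * k)) _ _ (begin
  2 * (T + p * p) + (n + 2 * (n * k))                   ≡⟨ regroup T p n k ⟩
  (T + T) + n + (2 * (p * p) + 2 * (n * k))             ≤⟨ +-monoˡ-≤ _ h₁ ⟩
  (n * a + n * a) + n * n + (2 * (p * p) + 2 * (n * k)) ≡⟨ collect a p n k ⟩
  2 * (n * (k + a)) + (n * n + 2 * (p * p))             ≤⟨ +-monoˡ-≤ _ (*-monoʳ-≤ 2 h₂) ⟩
  -- Twice the margin is `n (n − 3) + 2 (n − 2) y`, nonnegative because `n ≥ 3`.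
  2 * (k * k) + (n * n + 2 * (p * p))                   ≤⟨ m≤m+n _ ((3 + x) * x + (2 + 2 * x) * y) ⟩
  2 * (k * k) + (n * n + 2 * (p * p)) + ((3 + x) * x + (2 + 2 * x) * y) ≡⟨ slack x y ⟩
  2 * (q * q) + (n + 2 * (n * k))                       ∎))
  where
  open ≤-Reasoning
  n = 3 + x
  p = 2 + x
  q = 5 + (x + x) + y
  k = suc q
  regroup : ∀ T p n k → 2 * (T + p * p) + (n + 2 * (n * k)) ≡ (T + T) + n + (2 * (p * p) + 2 * (n * k))
  regroup = solve-∀
  collect : ∀ a p n k → (n * a + n * a) + n * n + (2 * (p * p) + 2 * (n * k)) ≡ 2 * (n * (k + a)) + (n * n + 2 * (p * p))
  collect = solve-∀
  slack : ∀ x y → let n = 3 + x ; p = 2 + x ; q = 5 + (x + x) + y ; k = suc q in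
    2 * (k * k) + (n * n + 2 * (p * p)) + ((3 + x) * x + (2 + 2 * x) * y) ≡ 2 * (q * q) + (n + 2 * (n * k))
  slack = solve-∀

-- Put `d = suc e`. If `a ≥ 2d`, then `n (n + 3d) ≤ (n + d)²`, so `n d ≤ d²`, against `d < n`. The
-- bound is what a ball of radius `e` covers on a path.
excess-bound : ∀ n e a → suc e < n → n * (n + suc e + a) ≤ (n + suc e) * (n + suc e) → a ≤ suc (e + e)
excess-bound n e a e<n bound = ≮⇒≥ λ long → <⇒≱ e<n (*-cancelʳ-≤ n (suc e) (suc e)
  (+-cancelˡ-≤ (n * n + 2 * (n * suc e)) _ _ (begin
    (n * n + 2 * (n * suc e)) + n * suc e          ≡⟨ regroup n e ⟩
    n * (n + suc e + suc (suc (e + e)))            ≤⟨ *-monoʳ-≤ n (+-monoʳ-≤ (n + suc e) long) ⟩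
    n * (n + suc e + a)                            ≤⟨ bound ⟩
    (n + suc e) * (n + suc e)                      ≡⟨ expand n e ⟩
    (n * n + 2 * (n * suc e)) + suc e * suc e      ∎)))
  where
  open ≤-Reasoning
  regroup : ∀ n e → (n * n + 2 * (n * suc e)) + n * suc e ≡ n * (n + suc e + suc (suc (e + e)))
  regroup = solve-∀
  expand : ∀ n e → (n + suc e) * (n + suc e) ≡ (n * n + 2 * (n * suc e)) + suc e * suc e
  expand = solve-∀

-- The `2d + 3` teeth swallowed by a ball of radius `k = m + d` hold `(2d + 3) m ≥ 2k + 1` vertices,
-- and `2k + 1` is the difference of the two squares.
wide-bound : ∀ N d m .{{_ : NonZero m}} → N * m ≤ suc (m + d) * suc (m + d) →
  (N ∸ suc (suc d + suc d)) * m ≤ (m + d) * (m + d)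
wide-bound N d (suc m) bound with ≤-total N (suc (suc d + suc d))
... | inj₁ N≤ rewrite m≤n⇒m∸n≡0 N≤ = z≤n
... | inj₂ ≤N = +-cancelʳ-≤ (suc ((suc m + d) + (suc m + d))) _ _ (begin
  R * suc m + suc ((suc m + d) + (suc m + d))                         ≤⟨ m≤m+n _ (m + 2 * (d * m)) ⟩
  R * suc m + suc ((suc m + d) + (suc m + d)) + (m + 2 * (d * m))     ≡⟨ collect R d m ⟩
  (suc (suc d + suc d) + R) * suc m                                   ≡⟨ cong (_* suc m) (m+[n∸m]≡n ≤N) ⟩
  N * suc m                                                           ≤⟨ bound ⟩
  suc (suc m + d) * suc (suc m + d)                                   ≡⟨ expand (suc m + d) ⟩
  (suc m + d) * (suc m + d) + suc ((suc m + d) + (suc m + d))         ∎)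
  where
  open ≤-Reasoning
  R = N ∸ suc (suc d + suc d)
  collect : ∀ R d m → R * suc m + suc ((suc m + d) + (suc m + d)) + (m + 2 * (d * m)) ≡ (suc (suc d + suc d) + R) * suc m
  collect = solve-∀
  expand : ∀ k → suc k * suc k ≡ k * k + suc (k + k)
  expand = solve-∀

-- Coordinates and paths in the comb.

toℕ-mod : ∀ {a b} .{{_ : NonZero b}} → a < b → toℕ (a mod b) ≡ a
toℕ-mod a<b = trans (toℕ-fromℕ< _) (m<n⇒m%n≡m a<b)

suc-mod : ∀ {a b} .{{_ : NonZero b}} → suc a < b → suc (toℕ (a mod b)) ≡ toℕ (suc a mod b)
suc-mod a+1<b = trans (cong suc (toℕ-mod (<⇒≤ a+1<b))) (sym (toℕ-mod a+1<b))

module _ (n m : ℕ) .{{_ : NonZero n}} .{{_ : NonZero m}} where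

  private
    C : Graph
    C = Comb n m

  -- Out-of-range coordinates wrap around; only in-range ones carry meaning.
  vertex : ℕ → ℕ → V C
  vertex i j = i mod m , j mod n

  vertex-toℕ : ∀ i j → vertex (toℕ i) (toℕ j) ≡ (i , j)
  vertex-toℕ i j = cong₂ _,_ (toℕ-injective (toℕ-mod (toℕ<n i))) (toℕ-injective (toℕ-mod (toℕ<n j)))

  comb-sym : ∀ {u v} → CombAdj n m u v → CombAdj n m v u
  comb-sym (spineR i j j′ p q) = spineL i j′ j p q
  comb-sym (spineL i j j′ p q) = spineR i j′ j p q
  comb-sym (toothD i i′ j p)   = toothU i′ i j p
  comb-sym (toothU i i′ j p)   = toothD i′ i j p

  tooth-adj : ∀ i j → suc i < m → CombAdj n m (vertex i j) (vertex (suc i) j)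
  tooth-adj i j lt = toothD _ _ _ (suc-mod lt)

  spine-adj : ∀ j → suc j < n → CombAdj n m (vertex 0 j) (vertex 0 (suc j))
  spine-adj j lt = spineR _ _ _ (toℕ-mod (>-nonZero⁻¹ m)) (suc-mod lt)

  segment : ∀ l (f : ℕ → V C) → (∀ t → suc t < l → CombAdj n m (f t) (f (suc t))) → Segment {C}
  segment l f adj = record { len = l ; at = f ; next = adj ; prev = λ t lt → comb-sym (adj t lt) }

  tooth : ℕ → Segment {C}
  tooth j = segment m (λ t → vertex t j) (λ t → tooth-adj t j)

  spine : Segment {C}
  spine = segment n (vertex 0) spine-adj

  spine-reach : ∀ {r c} i j → c < n → ∣ c - toℕ j ∣ + toℕ i ≤ r → Reach C r (vertex 0 c) (i , j)
  spine-reach {r} {c} i j c<n le = subst (Reach C r (vertex 0 c)) (vertex-toℕ i j)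
    (reach-mono le (reach-trans (segment-reach spine c<n (toℕ<n j))
      (segment-reach (tooth (toℕ j)) (>-nonZero⁻¹ m) (toℕ<n i))))

  on-tooth : ∀ i j → (i , j) On tooth (toℕ j)
  on-tooth i j = toℕ i , toℕ<n i , vertex-toℕ i j

  FirstTeeth : ℕ → V C → Set
  FirstTeeth N (i , j) = toℕ j < N

  -- Two teeth as one path: from the tip of tooth `0` to the spine, across one spine edge, and out
  -- to the tip of tooth `1`.
  twoTeethAt : ℕ → V C
  twoTeethAt t with t <? m
  ... | yes _ = vertex (m ∸ suc t) 0
  ... | no _  = vertex (t ∸ m) 1

  twoTeeth-left : ∀ {t} → t < m → twoTeethAt t ≡ vertex (m ∸ suc t) 0
  twoTeeth-left {t} t<m with t <? m
  ... | yes _  = refl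
  ... | no t≮m = contradiction t<m t≮m

  twoTeeth-right : ∀ {t} → m ≤ t → twoTeethAt t ≡ vertex (t ∸ m) 1
  twoTeeth-right {t} m≤t with t <? m
  ... | yes t<m = contradiction m≤t (<⇒≱ t<m)
  ... | no _    = refl

  twoTeeth : 1 < n → Segment {C}
  twoTeeth 1<n = segment (m + m) twoTeethAt adj
    where
    adj : ∀ t → suc t < m + m → CombAdj n m (twoTeethAt t) (twoTeethAt (suc t))
    adj t lt with t <? m | suc t <? m
    ... | yes _   | yes st<m = comb-sym (subst (λ h → CombAdj n m (vertex (m ∸ suc (suc t)) 0) (vertex h 0))
          (sym (+-∸-assoc 1 st<m)) (tooth-adj (m ∸ suc (suc t)) 0
            (subst (_< m) (+-∸-assoc 1 st<m) (m∸1+n<m t (>-nonZero⁻¹ m)))))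
    -- Here `suc t = m`: both positions are `0`, and the edge is the spine edge.
    ... | yes t<m | no st≮m = subst₂ (λ g h → CombAdj n m (vertex g 0) (vertex h 1))
          (sym (m≤n⇒m∸n≡0 (≮⇒≥ st≮m))) (sym (m≤n⇒m∸n≡0 t<m)) (spine-adj 0 1<n)
    ... | no t≮m  | yes st<m = contradiction (<⇒≤ st<m) t≮m
    ... | no t≮m  | no _ = subst (λ h → CombAdj n m (vertex (t ∸ m) 1) (vertex h 1))
          (sym (+-∸-assoc 1 (≮⇒≥ t≮m))) (tooth-adj (t ∸ m) 1
            (subst (_< m) (+-∸-assoc 1 (≮⇒≥ t≮m)) (m<n+o⇒m∸n<o (suc t) m lt)))

  on-twoTeeth : ∀ 1<n i j → toℕ j < 2 → (i , j) On twoTeeth 1<n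
  on-twoTeeth 1<n i j j<2 with toℕ j in eq
  ... | 0 = m ∸ suc (toℕ i) , ≤-trans (m∸1+n<m (toℕ i) (>-nonZero⁻¹ m)) (m≤m+n m m) ,
        trans (twoTeeth-left (m∸1+n<m (toℕ i) (>-nonZero⁻¹ m)))
          (trans (cong₂ vertex flip (sym eq)) (vertex-toℕ i j))
    where
    flip : m ∸ suc (m ∸ suc (toℕ i)) ≡ toℕ i
    flip = trans (cong (m ∸_) (sym (+-∸-assoc 1 (toℕ<n i)))) (m∸[m∸n]≡n (<⇒≤ (toℕ<n i)))
  ... | 1 = m + toℕ i , +-monoʳ-< m (toℕ<n i) ,
        trans (twoTeeth-right (m≤m+n m (toℕ i)))
          (trans (cong₂ vertex (m+n∸m≡n m (toℕ i)) (sym eq)) (vertex-toℕ i j))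
  ... | suc (suc _) = contradiction j<2 λ { (s≤s (s≤s ())) }

  -- What a ball at the end of the spine leaves over.

  -- A ball of radius `k − 1` about `vertex 0 0` spends `j` steps on the spine, so it burns tooth
  -- `j` to a depth of `k ∸ j` vertices.
  cut-tooth : ℕ → ℕ → Segment {C}
  cut-tooth k j = skip (k ∸ j) (tooth j)

  len-cut-tooth : ∀ {k a} → k + a ≡ m → ∀ j → len (cut-tooth k j) ≤ a + j
  len-cut-tooth {k} {a} refl j = m≤n+o⇒m∸n≤o (k + a) (k ∸ j) (begin
    k + a               ≤⟨ +-monoˡ-≤ a (m≤n+m∸n k j) ⟩
    j + (k ∸ j) + a     ≡⟨ regroup j (k ∸ j) a ⟩
    (k ∸ j) + (a + j)   ∎)
    where
    open ≤-Reasoning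
    regroup : ∀ j x a → j + x + a ≡ x + (a + j)
    regroup = solve-∀

  -- The inequality is returned as well because in `square-comb` it shows that tooth `0` has no
  -- survivor.
  corner-split : ∀ q i j → Reach C q (vertex 0 0) (i , j) ⊎ (suc q ≤ toℕ i + toℕ j × (i , j) On cut-tooth (suc q) (toℕ j))
  corner-split q i j with toℕ i + toℕ j ≤? q
  ... | yes near = inj₁ (spine-reach i j (>-nonZero⁻¹ n) (subst (_≤ q) (+-comm (toℕ i) (toℕ j)) near))
  ... | no far = inj₂ (≰⇒> far , subst (_On cut-tooth (suc q) (toℕ j)) (vertex-toℕ i j)
        (on-skip (tooth (toℕ j)) (m≤n+o⇒m∸n≤o (suc q) (toℕ j) (subst (suc q ≤_) (+-comm (toℕ i) (toℕ j)) (≰⇒> far))) (toℕ<n i)))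

  corner-burns : ∀ q N → Burns C q (OnAny (indexed (cut-tooth (suc q)) N)) → Burns C (suc q) (FirstTeeth N)
  corner-burns q N = ignite (vertex 0 0) split
    where
    split : ∀ u → FirstTeeth N u → Reach C q (vertex 0 0) u ⊎ OnAny (indexed (cut-tooth (suc q)) N) u
    split (i , j) j<N with corner-split q i j
    ... | inj₁ near     = inj₁ near
    ... | inj₂ (_ , on) = inj₂ (on-indexed j<N on)

  -- Here N = k = m, so tooth 0 is burnt entirely by the corner ball and k − 1 balls serve the other k − 1 teeth.
  square-comb : ∀ q → m ≤ suc q → (∀ j → len (cut-tooth (suc q) j) ≤ j) → Burns C (suc q) (FirstTeeth (suc q))
  square-comb q m≤k len≤ = ignite (vertex 0 0) split
    (subst (λ x → Burns C x (OnAny tails)) (length-indexed _ q)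
      -- Tooth `suc j` keeps at most `suc j ≤ 2j + 1` vertices, within a ball of radius `j`.
      (fits⇒burns {e = 0} (vertex 0 0) (indexed-fits q λ j → ≤-trans (len≤ (suc j)) (s≤s (m≤m+n j j)))))
    where
    tails : List (Segment {C})
    tails = indexed (λ j → cut-tooth (suc q) (suc j)) q

    split : ∀ u → FirstTeeth (suc q) u → Reach C q (vertex 0 0) u ⊎ OnAny tails u
    split (i , j) j<k with corner-split q i j
    ... | inj₁ near = inj₁ near
    ... | inj₂ (far , on) with toℕ j
    ...   | zero  = contradiction (subst (suc q ≤_) (+-identityʳ (toℕ i)) far) (<⇒≱ (≤-trans (toℕ<n i) m≤k))
    ...   | suc _ = inj₂ (on-indexed (s≤s⁻¹ j<k) on)

  -- Burning an initial block of teeth.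

  -- One or two teeth are treated as single paths because the margin in `tails-bound` would be
  -- negative for them.
  few-teeth : ∀ k N → k ≤ m → N ≤ n → N * m ≤ k * k → Burns C k (FirstTeeth N)
  few-teeth k 0 _ _ _ = burns-empty (vertex 0 0) λ _ ()
  few-teeth k 1 _ _ bound = burns-cong on-first
    (burns-segment (tooth 0) (vertex 0 0) (>-nonZero⁻¹ m) (subst (_≤ k * k) (+-identityʳ m) bound))
    where
    on-first : ∀ u → FirstTeeth 1 u → u On tooth 0
    on-first (i , j) j<1 = subst (λ x → (i , j) On tooth x) (n<1⇒n≡0 j<1) (on-tooth i j)
  few-teeth k 2 _ 1<n bound = burns-cong (λ (i , j) → on-twoTeeth 1<n i j)
    (burns-segment (twoTeeth 1<n) (vertex 0 0) (≤-trans (>-nonZero⁻¹ m) (m≤m+n m m))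
      (subst (λ x → m + x ≤ k * k) (+-identityʳ m) bound))
  few-teeth zero (suc (suc (suc x))) _ _ bound =
    contradiction bound (<⇒≱ (≤-trans (>-nonZero⁻¹ m) (m≤m+n m _)))
  few-teeth (suc q) N@(suc (suc (suc x))) k≤m N≤n bound with N + N ≤? suc q
  ... | yes 2N≤k = corner-burns q N (burns-segments q tails (vertex 0 0)
        (subst (_≤ q) (sym length≡) N≤q)
        (subst₂ (λ l r → total tails + pred l * pred l ≤ r * r) (sym length≡) q≡
          (tails-bound x y (m ∸ suc q) (total tails) (total-indexed {f = cut-tooth (suc q)} N (len-cut-tooth {suc q} (m+[n∸m]≡n k≤m)))
            (subst₂ (λ z r → N * z ≤ suc r * suc r)
              (trans (sym (m+[n∸m]≡n k≤m)) (cong (λ r → suc r + (m ∸ suc q)) (sym q≡))) (sym q≡) bound))))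
    where
    tails : List (Segment {C})
    tails = indexed (cut-tooth (suc q)) N
    length≡ : length tails ≡ N
    length≡ = length-indexed (cut-tooth (suc q)) N
    -- With `N = 3 + x`, this gives `q = 5 + 2x + y`, the shape that `tails-bound` expects.
    y = suc q ∸ (N + N)
    regroup : ∀ x y → 5 + (x + x) + y ≡ (2 + x) + (3 + x) + y
    regroup = solve-∀
    q≡ : 5 + (x + x) + y ≡ q
    q≡ = trans (regroup x y) (suc-injective (m+[n∸m]≡n 2N≤k))
    N≤q : N ≤ q
    N≤q = ≤-trans (m≤n+m N (2 + x)) (s≤s⁻¹ 2N≤k)
  ... | no 2N≰k = one-each (suc q ∸ N) (m+[n∸m]≡n N≤k)
    where
    N≤k : N ≤ suc q
    N≤k = *-cancelʳ-≤ N (suc q) (suc q) (≤-trans (*-monoʳ-≤ N k≤m) bound)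

    k+a≡m : suc q + (m ∸ suc q) ≡ m
    k+a≡m = m+[n∸m]≡n k≤m

    -- The corner ball leaves `k − 1` balls, where `k = suc q`. For `N = k` that is one too few for
    -- `N` paths, but then `k m ≤ k²` forces `m = k` and tooth `0` leaves no path.
    one-each : ∀ e → N + e ≡ suc q → Burns C (suc q) (FirstTeeth N)
    one-each zero N≡k = subst (λ x → Burns C (suc q) (FirstTeeth x)) (sym N≡k′) (square-comb q m≤k
      λ j → subst (λ a → len (cut-tooth (suc q) j) ≤ a + j) (m≤n⇒m∸n≡0 m≤k) (len-cut-tooth k+a≡m j))
      where
      N≡k′ : N ≡ suc q
      N≡k′ = trans (sym (+-identityʳ N)) N≡k
      m≤k : m ≤ suc q
      m≤k = *-cancelˡ-≤ (suc q) (subst (λ x → x * m ≤ suc q * suc q) N≡k′ bound)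
    one-each (suc e) N+e≡k = corner-burns q N (subst (λ x → Burns C x (OnAny tails)) length≡
      (fits⇒burns (vertex 0 0) (indexed-fits N fits)))
      where
      tails : List (Segment {C})
      tails = indexed (cut-tooth (suc q)) N
      length≡ : e + length tails ≡ q
      length≡ = trans (cong (e +_) (length-indexed (cut-tooth (suc q)) N))
        (suc-injective (trans (cong suc (+-comm e N)) (trans (sym (+-suc N e)) N+e≡k)))
      e<N : suc e < N
      e<N = +-cancelˡ-< N (suc e) N (subst (_< N + N) (sym N+e≡k) (≰⇒> 2N≰k))
      a≤ : m ∸ suc q ≤ suc (e + e)
      a≤ = excess-bound N e (m ∸ suc q) e<N
        (subst₂ (λ z r → N * z ≤ r * r)
          (trans (sym k+a≡m) (cong (_+ (m ∸ suc q)) (sym N+e≡k))) (sym N+e≡k) bound)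
      regroup : ∀ e j → suc (e + e) + j + j ≡ suc ((e + j) + (e + j))
      regroup = solve-∀
      fits : ∀ j → len (cut-tooth (suc q) j) ≤ suc ((e + j) + (e + j))
      fits j = ≤-trans (len-cut-tooth k+a≡m j)
        (≤-trans (+-monoˡ-≤ j a≤) (≤-trans (m≤m+n _ j) (≤-reflexive (regroup e j))))

  -- Wide balls consume teeth from the far end of the spine, so the unburnt ones always form an
  -- initial block, with a corner at `vertex 0 0` for `few-teeth`.
  burns-teeth : ∀ k N → N ≤ n → N * m ≤ k * k → Burns C k (FirstTeeth N)
  burns-teeth zero    N N≤n bound = few-teeth 0 N z≤n N≤n bound
  burns-teeth (suc k) N N≤n bound with suc k ≤? m
  ... | yes k<m = few-teeth (suc k) N k<m N≤n bound
  ... | no k≮m = ignite (vertex 0 centre) split (burns-teeth k (N ∸ suc (w + w)) (≤-trans (m∸n≤m N (suc (w + w))) N≤n)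
        (subst (λ x → (N ∸ suc (w + w)) * m ≤ x * x) k≡
          (wide-bound N (k ∸ m) m (subst (λ x → N * m ≤ suc x * suc x) (sym k≡) bound))))
    where
    -- Since `w + (m − 1) = k`, the ball swallows every tooth within spine distance `w`. The centre
    -- lies `w` teeth before the last one; if `N ≤ suc w` it is truncated to tooth `0`, which still
    -- has all `N` teeth within distance `w`.
    w = suc (k ∸ m)
    centre = N ∸ suc w
    k≡ : m + (k ∸ m) ≡ k
    k≡ = m+[n∸m]≡n (s≤s⁻¹ (≰⇒> k≮m))

    split : ∀ u → FirstTeeth N u → Reach C k (vertex 0 centre) u ⊎ FirstTeeth (N ∸ suc (w + w)) u
    split (i , j) j<N with toℕ j <? N ∸ suc (w + w)
    ... | yes j< = inj₂ j<
    ... | no j≮ = inj₁ (spine-reach i j (≤-trans (m∸1+n<m w (≤-<-trans z≤n j<N)) N≤n) (begin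
      ∣ centre - toℕ j ∣ + toℕ i ≤⟨ +-monoˡ-≤ (toℕ i) (∣m-n∣≤ centre≤ j≤) ⟩
      w + toℕ i                  ≡⟨ +-suc (k ∸ m) (toℕ i) ⟨
      (k ∸ m) + suc (toℕ i)      ≤⟨ +-monoʳ-≤ (k ∸ m) (toℕ<n i) ⟩
      (k ∸ m) + m                ≡⟨ +-comm (k ∸ m) m ⟩
      m + (k ∸ m)                ≡⟨ k≡ ⟩
      k                          ∎))
      where
      open ≤-Reasoning
      regroup : ∀ w j → suc (w + w) + j ≡ suc w + (j + w)
      regroup = solve-∀
      centre≤ : centre ≤ toℕ j + w
      centre≤ = m≤n+o⇒m∸n≤o N (suc w) (subst (N ≤_) (regroup w (toℕ j))
        (≤-trans (m≤n+m∸n N (suc (w + w))) (+-monoʳ-≤ (suc (w + w)) (≮⇒≥ j≮))))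
      j≤ : toℕ j ≤ centre + w
      j≤ = s≤s⁻¹ (≤-trans j<N (≤-trans (m≤n+m∸n N (suc w)) (≤-reflexive (cong suc (+-comm w centre)))))

theorem1p4 : (n m : ℕ) → 1 ≤ n → 1 ≤ m → (c : ℕ) → IsCeilSqrt (n * m) c →
    BurningNumber≤ (Comb n m) c
theorem1p4 n m 1≤n 1≤m c (nm≤c² , _) = c , ≤-refl , proj₁ burning , λ u → proj₂ burning u (toℕ<n (proj₂ u))
  where
  instance
    n≢0 : NonZero n
    n≢0 = >-nonZero 1≤n
    m≢0 : NonZero m
    m≢0 = >-nonZero 1≤m
  burning : Burns (Comb n m) c (FirstTeeth n m n)
  burning = burns-teeth n m c n ≤-refl nm≤c²
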